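{- Let $\overrightarrow{W}$ be a Morse sequence on a simplicial complex $K$, with reference map $\curlywedge$ and coreference map $\curlyvee$. (1) If $z,z'\in Z_p(K)$ and $\curlywedge(z)=\curlywedge(z')$, then $z+z'\in B_p(K)$, i.e. $z$ and $z'$ are homologous. (2) If $z,z'\in Z^p(K)$ and $\curlyvee(z)=\curlyvee(z')$, then $z+z'\in B^p(K)$, i.e. $z$ and $z'$ are cohomologous.
   Context: A simplicial complex $K$ is a finite collection of non-empty finite sets closed under taking non-empty subsets; $\dim\sigma=|\sigma|-1$, $K^{(p)}$ the set of $p$-simplices. A pair $(\sigma,\tau)$ with $\sigma\subsetneq\tau$ is a free pair for $K$ if $\tau$ is the only simplex other than $\sigma$ containing $\sigma$; $K$ is then an elementary expansion of $K\setminus\{\sigma,\tau\}$. If $\nu$ is a facet (maximal simplex) of $K$, $K$ is an elementary filling of $K\setminus\{\nu\}$. A Morse sequence on $K$ is a sequence $\langle\emptyset=K_0,\dots,K_k=K\rangle$ with each $K_i$ an elementary expansion or filling of $K_{i-1}$; simplices added by fillings are critical; for an expansion $K_i=K_{i-1}\cup\{\sigma,\tau\}$, $\sigma\subset\tau$, $\sigma$ is lower regular and $\tau$ upper regular. $K[p]$ is the $\mathbb{Z}_2$-vector space of subsets of $K^{(p)}$ (sum = symmetric difference, $0=\emptyset$). For $\sigma\in K^{(p)}$, $\partial(\sigma)=\{\tau\in K^{(p-1)}:\tau\subset\sigma\}$, $\delta(\sigma)=\{\tau\in K^{(p+1)}:\sigma\subset\tau\}$, extended linearly to $\partial_p:K[p]\to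 K[p-1]$, $\delta_p:K[p]\to K[p+1]$; $Z_p(K)=\ker\partial_p$, $B_p(K)=\operatorname{im}\partial_{p+1}$, $Z^p(K)=\ker\delta_p$, $B^p(K)=\operatorname{im}\delta_{p-1}$. The reference map $\curlywedge$ is the unique map assigning to each $p$-simplex a set of critical $p$-simplices, extended linearly (mod 2), with $\curlywedge(\nu)=\{\nu\}$ for critical $\nu$ and $\curlywedge(\tau)=0=\curlywedge(\partial(\tau))$ for upper regular $\tau$; the coreference map $\curlyvee$ is the unique such map with $\curlyvee(\nu)=\{\nu\}$ for critical $\nu$ and $\curlyvee(\sigma)=0=\curlyvee(\delta(\sigma))$ for lower regular $\sigma$. -}

module Defs where

open import Data.Bool.Base using (Bool; true; false; not; _∧_; _∨_; _xor_)
import Data.Bool.Properties as Bool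
open import Data.Empty using (⊥)
open import Data.Fin.Subset using (Subset; inside; outside; _⊆_; _⊂_; Nonempty; ∣_∣)
open import Data.Fin.Subset.Properties using (_⊆?_)
open import Data.Integer.Base using (ℤ; +_; _+_; _-_; 1ℤ)
import Data.Integer.Properties as ℤ
open import Data.Nat.Base using (ℕ; zero; suc)
open import Data.Product.Base using (∃; _×_)
open import Data.Sum.Base using (_⊎_)
open import Data.Vec.Base using ([]; _∷_)
open import Data.Vec.Properties using (≡-dec)
open import Relation.Binary.Definitions using (DecidableEquality)
open import Relation.Binary.PropositionalEquality using (_≡_; _≢_; _≗_)
open import Relation.Nullary.Decidable using (does)

infix 4 _≟ˢ_ _∈ᶠ_
infixl 6 _⊕_
infixl 6 _∖_

_≟ˢ_ : ∀ {n} → DecidableEquality (Subset n)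
_≟ˢ_ = ≡-dec Bool._≟_

-- A (necessarily finite) collection of subsets of Fin n, given by its
-- indicator function.  Two collections are equal when they are so pointwise (_≗_).
Family : ℕ → Set
Family n = Subset n → Bool

_∈ᶠ_ : ∀ {n} → Subset n → Family n → Set
σ ∈ᶠ C = C σ ≡ true

∅ᶠ : ∀ {n} → Family n
∅ᶠ _ = false

⟦_⟧ : ∀ {n} → Subset n → Family n
⟦ σ ⟧ ρ = does (ρ ≟ˢ σ)

⟦_∣_⟧ : ∀ {n} → Subset n → Subset n → Family n
⟦ σ ∣ τ ⟧ ρ = ⟦ σ ⟧ ρ ∨ ⟦ τ ⟧ ρ

_∖_ : ∀ {n} → Family n → Family n → Family n
(C ∖ D) ρ = C ρ ∧ not (D ρ)

-- Symmetric difference: the sum of ℤ₂-chains.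
_⊕_ : ∀ {n} → Family n → Family n → Family n
(C ⊕ D) ρ = C ρ xor D ρ

record SimplicialComplex (n : ℕ) : Set where
  field
    simplices : Family n
    nonempty  : ∀ {σ} → σ ∈ᶠ simplices → Nonempty σ
    closed    : ∀ {σ τ} → σ ∈ᶠ simplices → τ ⊆ σ → Nonempty τ → τ ∈ᶠ simplices

open SimplicialComplex public

-- Integer-valued, so that K ⁽ p ⁾ makes sense (and is empty) for p = -1.
dim : ∀ {n} → Subset n → ℤ
dim σ = + ∣ σ ∣ - 1ℤ

_⁽_⁾ : ∀ {n} → SimplicialComplex n → ℤ → Family n
(K ⁽ p ⁾) σ = simplices K σ ∧ does (dim σ ℤ.≟ p)

record FreePair {n} (K : SimplicialComplex n) (σ τ : Subset n) : Set where
  field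
    σ∈K  : σ ∈ᶠ simplices K
    τ∈K  : τ ∈ᶠ simplices K
    σ⊂τ  : σ ⊂ τ
    only : ∀ {ρ} → ρ ∈ᶠ simplices K → σ ⊆ ρ → ρ ≢ σ → ρ ≡ τ

record Facet {n} (K : SimplicialComplex n) (ν : Subset n) : Set where
  field
    ν∈K     : ν ∈ᶠ simplices K
    maximal : ∀ {ρ} → ρ ∈ᶠ simplices K → ν ⊆ ρ → ρ ≡ ν

-- K is an elementary expansion of L, by the free pair (σ , τ) of K.
record ElementaryExpansion {n} (L K : SimplicialComplex n) (σ τ : Subset n) : Set where
  field
    freePair : FreePair K σ τ
    removal  : simplices L ≗ simplices K ∖ ⟦ σ ∣ τ ⟧

-- K is an elementary filling of L, by the facet ν of K.
record ElementaryFilling {n} (L K : SimplicialComplex n) (ν : Subset n) : Set where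
  field
    facet   : Facet K ν
    removal : simplices L ≗ simplices K ∖ ⟦ ν ⟧

-- The sequences ⟨ ∅ = K₀ , … , K_k = K ⟩, as snoc-lists indexed by the last complex.
data MorseSequence {n} : SimplicialComplex n → Set where
  start  : ∀ {K} → simplices K ≗ ∅ᶠ → MorseSequence K
  expand : ∀ {L K} → MorseSequence L →
           (σ τ : Subset n) → ElementaryExpansion L K σ τ → MorseSequence K
  fill   : ∀ {L K} → MorseSequence L →
           (ν : Subset n) → ElementaryFilling L K ν → MorseSequence K

Critical : ∀ {n} {K : SimplicialComplex n} → MorseSequence K → Subset n → Set
Critical (start _)        ρ = ⊥
Critical (expand W _ _ _) ρ = Critical W ρ
Critical (fill W ν _)     ρ = Critical W ρ ⊎ ρ ≡ ν

LowerRegular : ∀ {n} {K : SimplicialComplex n} → MorseSequence K → Subset n → Set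
LowerRegular (start _)        ρ = ⊥
LowerRegular (expand W σ _ _) ρ = LowerRegular W ρ ⊎ ρ ≡ σ
LowerRegular (fill W _ _)     ρ = LowerRegular W ρ

UpperRegular : ∀ {n} {K : SimplicialComplex n} → MorseSequence K → Subset n → Set
UpperRegular (start _)        ρ = ⊥
UpperRegular (expand W _ τ _) ρ = UpperRegular W ρ ⊎ ρ ≡ τ
UpperRegular (fill W _ _)     ρ = UpperRegular W ρ

-- c ∈ K[p]
IsChain : ∀ {n} → SimplicialComplex n → ℤ → Family n → Set
IsChain K p c = ∀ {σ} → σ ∈ᶠ c → σ ∈ᶠ K ⁽ p ⁾

-- The sum mod 2 of f σ over all subsets σ of Fin n.
sum₂ : ∀ {n} → (Subset n → Bool) → Bool
sum₂ {zero}  f = f []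
sum₂ {suc n} f = sum₂ (λ σ → f (outside ∷ σ)) xor sum₂ (λ σ → f (inside ∷ σ))

-- Linear extension: extend f c = Σ_{σ ∈ c} f σ, computed coefficientwise.
extend : ∀ {n} → (Subset n → Family n) → Family n → Family n
extend f c ρ = sum₂ (λ σ → c σ ∧ f σ ρ)

∂ˢ : ∀ {n} → SimplicialComplex n → Subset n → Family n
∂ˢ K σ τ = (K ⁽ dim σ - 1ℤ ⁾) τ ∧ does (τ ⊆? σ)

δˢ : ∀ {n} → SimplicialComplex n → Subset n → Family n
δˢ K σ τ = (K ⁽ dim σ + 1ℤ ⁾) τ ∧ does (σ ⊆? τ)

∂ : ∀ {n} → SimplicialComplex n → Family n → Family n
∂ K = extend (∂ˢ K)

δ : ∀ {n} → SimplicialComplex n → Family n → Family n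
δ K = extend (δˢ K)

-- z ∈ Z_p(K)
IsCycle : ∀ {n} → SimplicialComplex n → ℤ → Family n → Set
IsCycle K p z = IsChain K p z × ∂ K z ≗ ∅ᶠ

-- b ∈ B_p(K)
IsBoundary : ∀ {n} → SimplicialComplex n → ℤ → Family n → Set
IsBoundary K p b = ∃ λ c → IsChain K (p + 1ℤ) c × ∂ K c ≗ b

-- z ∈ Z^p(K)
IsCocycle : ∀ {n} → SimplicialComplex n → ℤ → Family n → Set
IsCocycle K p z = IsChain K p z × δ K z ≗ ∅ᶠ

-- b ∈ B^p(K)
IsCoboundary : ∀ {n} → SimplicialComplex n → ℤ → Family n → Set
IsCoboundary K p b = ∃ λ c → IsChain K (p - 1ℤ) c × δ K c ≗ b

-- Reference and coreference maps are maps on the simplices of K; the values of f outside K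
-- are unconstrained and play no role, since chains are supported in K.
record IsReferenceMap {n} {K : SimplicialComplex n} (W : MorseSequence K)
                      (f : Subset n → Family n) : Set where
  field
    critical-valued : ∀ {σ ν} → σ ∈ᶠ simplices K → ν ∈ᶠ f σ →
                      Critical W ν × dim ν ≡ dim σ
    on-critical     : ∀ {ν} → Critical W ν → f ν ≗ ⟦ ν ⟧
    on-upper        : ∀ {τ} → UpperRegular W τ → f τ ≗ ∅ᶠ
    on-∂-upper      : ∀ {τ} → UpperRegular W τ → extend f (∂ˢ K τ) ≗ ∅ᶠ

record IsCoreferenceMap {n} {K : SimplicialComplex n} (W : MorseSequence K)
                        (f : Subset n → Family n) : Set where
  field
    critical-valued : ∀ {σ ν} → σ ∈ᶠ simplices K → ν ∈ᶠ f σ →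
                      Critical W ν × dim ν ≡ dim σ
    on-critical     : ∀ {ν} → Critical W ν → f ν ≗ ⟦ ν ⟧
    on-lower        : ∀ {σ} → LowerRegular W σ → f σ ≗ ∅ᶠ
    on-δ-lower      : ∀ {σ} → LowerRegular W σ → extend f (δˢ K σ) ≗ ∅ᶠ

{-# OPTIONS --safe #-}

-- Homology and cohomology are two instances of one elimination.  Let y be a cycle with zero
-- reference, and read the Morse sequence backwards.  A critical simplex reached this way is not
-- in y, since it would survive in the reference of y; neither is an upper regular one, since its
-- partner would survive in ∂ y; and if a lower regular one is in y, adding ∂ of its partner
-- removes it without changing ∂ y (as ∂ ∂ = 0) or the reference of y.  In the end 0 is left.
-- For cocycles the sequence is read forwards, with lower and upper exchanged.
module Submission where

open import Defs
open import Data.Bool.Base using (true; false; not; _∧_; _∨_; _xor_)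
open import Data.Bool.Properties using (¬-not; xor-assoc; xor-same; xor-identityʳ; xor-∧-commutativeRing; ∧-comm; ∧-identityʳ; ∧-zeroʳ; ∧-distribʳ-xor)
open import Data.Empty using (⊥-elim)
open import Data.Fin.Subset using (Subset; inside; outside; _⊆_; _⊂_; Nonempty; ∣_∣)
open import Data.Fin.Subset.Properties using (_⊆?_; ⊆-reflexive; drop-∷-⊆; drop-∷-⊂; out⊆; s⊆s; p⊆q⇒∣p∣≤∣q∣)
open import Data.Integer.Base using (ℤ; +_; _+_; _-_; 1ℤ; -1ℤ)
import Data.Integer.Properties as ℤ
open import Data.Nat.Base using (ℕ; zero; suc)
import Data.Nat.Properties as ℕ
open import Data.Product.Base using (∃; _×_; _,_; proj₁; proj₂)
open import Data.Sum.Base using (_⊎_; inj₁; inj₂)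
open import Data.Vec.Base using ([]; _∷_; here)
open import Function.Base using (_∘_; flip; id)
open import Relation.Binary.PropositionalEquality using (_≡_; _≢_; _≗_; refl; sym; trans; cong; cong₂; subst; module ≡-Reasoning)
open import Relation.Nullary using (¬_; Dec; yes; no; contradiction)
open import Relation.Nullary.Decidable using (does; dec-true; dec-false)
open import Algebra.Properties.CommutativeSemigroup using (interchange)
open import Algebra.Bundles using (module CommutativeRing)

-- Booleans and indicator functions

∧-true⁻ : ∀ {a b} → a ∧ b ≡ true → a ≡ true × b ≡ true
∧-true⁻ {true} {true} _ = refl , refl

∧-true⁺ : ∀ {a b} → a ≡ true → b ≡ true → a ∧ b ≡ true
∧-true⁺ refl refl = refl

xor-true⁻ : ∀ a {b} → a xor b ≡ true → a ≡ true ⊎ b ≡ true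
xor-true⁻ true  _ = inj₁ refl
xor-true⁻ false e = inj₂ e

true≢false : ∀ {a} → a ≡ true → a ≢ false
true≢false refl ()

≡-by-true : ∀ {a b} → (a ≡ true → b ≡ true) → (b ≡ true → a ≡ true) → a ≡ b
≡-by-true {true}          f g = sym (f refl)
≡-by-true {false} {true}  f g = g refl
≡-by-true {false} {false} f g = refl

does⁻ : ∀ {A : Set} (a? : Dec A) → does a? ≡ true → A
does⁻ (yes a) _ = a

⟦⟧-refl : ∀ {n} (σ : Subset n) → ⟦ σ ⟧ σ ≡ true
⟦⟧-refl σ = dec-true (σ ≟ˢ σ) refl

⟦⟧-≢ : ∀ {n} {σ ρ : Subset n} → ρ ≢ σ → ⟦ σ ⟧ ρ ≡ false
⟦⟧-≢ {σ = σ} {ρ} = dec-false (ρ ≟ˢ σ)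

-- Sums modulo 2 and linear extensions

sum₂-cong : ∀ {n} {f g : Family n} → f ≗ g → sum₂ f ≡ sum₂ g
sum₂-cong {zero}  e = e []
sum₂-cong {suc n} e = cong₂ _xor_ (sum₂-cong (e ∘ (outside ∷_))) (sum₂-cong (e ∘ (inside ∷_)))

sum₂-zero : ∀ {n} {f : Family n} → f ≗ ∅ᶠ → sum₂ f ≡ false
sum₂-zero {zero}  e = e []
sum₂-zero {suc n} e = cong₂ _xor_ (sum₂-zero (e ∘ (outside ∷_))) (sum₂-zero (e ∘ (inside ∷_)))

sum₂-⊕ : ∀ {n} (f g : Family n) → sum₂ (f ⊕ g) ≡ sum₂ f xor sum₂ g
sum₂-⊕ {zero}  f g = refl
sum₂-⊕ {suc n} f g = trans
  (cong₂ _xor_ (sum₂-⊕ (f ∘ (outside ∷_)) (g ∘ (outside ∷_)))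
               (sum₂-⊕ (f ∘ (inside ∷_)) (g ∘ (inside ∷_))))
  (interchange (CommutativeRing.+-commutativeSemigroup xor-∧-commutativeRing)
    (sum₂ (f ∘ (outside ∷_))) _ _ _)

sum₂-single : ∀ {n} (f : Family n) σ → (∀ {ρ} → ρ ≢ σ → f ρ ≡ false) → sum₂ f ≡ f σ
sum₂-single {zero} f [] _ = refl
sum₂-single {suc n} f (outside ∷ σ) e = trans
  (cong₂ _xor_ (sum₂-single (f ∘ (outside ∷_)) σ (λ ne → e λ { refl → ne refl }))
               (sum₂-zero (λ ρ → e {inside ∷ ρ} λ ())))
  (xor-identityʳ _)
sum₂-single {suc n} f (inside ∷ σ) e =
  cong₂ _xor_ (sum₂-zero (λ ρ → e {outside ∷ ρ} λ ()))
              (sum₂-single (f ∘ (inside ∷_)) σ (λ ne → e λ { refl → ne refl }))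

-- Agreement is asked only on the support of `c`, because `∂ˢ K` and `δˢ K` agree with incidence
-- only at simplices of `K`.
extend-congˡ : ∀ {n} {f g : Subset n → Family n} {c} → (∀ {σ} → σ ∈ᶠ c → f σ ≗ g σ) →
               extend f c ≗ extend g c
extend-congˡ {f = f} {g} {c} e ρ = sum₂-cong go
  where
  go : ∀ σ → c σ ∧ f σ ρ ≡ c σ ∧ g σ ρ
  go σ with c σ in σ∈c
  ... | true  = e σ∈c ρ
  ... | false = refl

extend-congʳ : ∀ {n} (f : Subset n → Family n) {c c′} → c ≗ c′ → extend f c ≗ extend f c′
extend-congʳ f e ρ = sum₂-cong λ σ → cong (_∧ f σ ρ) (e σ)

extend-∅ : ∀ {n} (f : Subset n → Family n) → extend f ∅ᶠ ≗ ∅ᶠ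
extend-∅ {n} f ρ = sum₂-zero {n} λ _ → refl

extend-⊕ : ∀ {n} (f : Subset n → Family n) c c′ → extend f (c ⊕ c′) ≗ extend f c ⊕ extend f c′
extend-⊕ f c c′ ρ = trans (sum₂-cong λ σ → ∧-distribʳ-xor (f σ ρ) (c σ) (c′ σ))
  (sum₂-⊕ (λ σ → c σ ∧ f σ ρ) (λ σ → c′ σ ∧ f σ ρ))

-- The tool behind every "would survive" argument: at one fixed coefficient `ρ`, a single member of
-- `c` contributes, so nothing can cancel it.
extend-single : ∀ {n} (f : Subset n → Family n) {c} σ ρ → σ ∈ᶠ c →
                (∀ {π} → π ∈ᶠ c → π ≢ σ → f π ρ ≡ false) → extend f c ρ ≡ f σ ρ
extend-single f {c} σ ρ σ∈c e =
  trans (sum₂-single _ σ go) (cong (_∧ f σ ρ) σ∈c)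
  where
  go : ∀ {π} → π ≢ σ → c π ∧ f π ρ ≡ false
  go {π} ne with c π in π∈c
  ... | true  = e π∈c ne
  ... | false = refl

extend-⟦⟧ : ∀ {n} (f : Subset n → Family n) σ → extend f ⟦ σ ⟧ ≗ f σ
extend-⟦⟧ f σ ρ = extend-single f σ ρ (⟦⟧-refl σ)
  λ {π} π∈ ne → contradiction (does⁻ (π ≟ˢ σ) π∈) ne

extend-⊕-≡ : ∀ {n} (f : Subset n → Family n) c c′ → extend f c ≗ extend f c′ → extend f (c ⊕ c′) ≗ ∅ᶠ
extend-⊕-≡ f c c′ e ρ = trans (extend-⊕ f c c′ ρ)
  (trans (cong (_xor extend f c′ ρ) (e ρ)) (xor-same (extend f c′ ρ)))

-- Elimination along an acyclic matching

-- R holds the simplices still to be eliminated; in a pair, a is eliminated by adding d b.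
data Matching {n} (d f : Subset n → Family n) : (Subset n → Set) → Set₁ where
  none : ∀ {R} → (∀ {ρ} → ¬ R ρ) → Matching d f R
  crit : ∀ {R R′} ν → Matching d f R′ →
         (R⇒ : ∀ {ρ} → R ρ → R′ ρ ⊎ ρ ≡ ν) (R′⇒R : ∀ {ρ} → R′ ρ → R ρ)
         (ν∈R : R ν) (ν∉R′ : ¬ R′ ν) (fν : f ν ≗ ⟦ ν ⟧) → Matching d f R
  pair : ∀ {R R′} a b → Matching d f R′ →
         (R⇒ : ∀ {ρ} → R ρ → R′ ρ ⊎ ρ ≡ a ⊎ ρ ≡ b) (R′⇒R : ∀ {ρ} → R′ ρ → R ρ)
         (a∈db : a ∈ᶠ d b)
         (only-b : ∀ {ρ} → R ρ → ρ ≢ b → d ρ a ≡ false)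
         (db⇒ : ∀ {ρ} → ρ ∈ᶠ d b → R′ ρ ⊎ ρ ≡ a)
         (fb : f b ≗ ∅ᶠ) (fdb : extend f (d b) ≗ ∅ᶠ) → Matching d f R

module _ {n} {d f : Subset n → Family n} where

  -- By induction on the matching, `f` never leads out of `R`. The case with content is `a`: from
  -- `f (d b) = 0`, `f a` is the sum of `f` over the other members of `d b`, and these lie in `R′`,
  -- where induction applies. In `matching-exact` this keeps a critical simplex out of the reference
  -- of everything remaining after it.
  matching-support : ∀ {R} → Matching d f R → ∀ {σ ρ} → R σ → ¬ R ρ → f σ ρ ≡ false
  matching-support (none R∅) σ∈R _ = ⊥-elim (R∅ σ∈R)
  matching-support (crit ν M R⇒ R′⇒R ν∈R _ fν) {ρ = ρ} σ∈R ρ∉R with R⇒ σ∈R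
  ... | inj₁ σ∈R′ = matching-support M σ∈R′ (ρ∉R ∘ R′⇒R)
  ... | inj₂ refl = trans (fν ρ) (⟦⟧-≢ {σ = ν} {ρ} λ { refl → ρ∉R ν∈R })
  matching-support (pair a b M R⇒ R′⇒R a∈db _ db⇒ fb fdb) {ρ = ρ} σ∈R ρ∉R with R⇒ σ∈R
  ... | inj₁ σ∈R′        = matching-support M σ∈R′ (ρ∉R ∘ R′⇒R)
  ... | inj₂ (inj₂ refl) = fb ρ
  ... | inj₂ (inj₁ refl) = trans (sym (extend-single f a ρ a∈db others)) (fdb ρ)
    where
    others : ∀ {π} → π ∈ᶠ d b → π ≢ a → f π ρ ≡ false
    others π∈db π≢a with db⇒ π∈db
    ... | inj₁ π∈R′ = matching-support M π∈R′ (ρ∉R ∘ R′⇒R)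
    ... | inj₂ π≡a  = contradiction π≡a π≢a

  module _ (dd : ∀ σ → extend d (d σ) ≗ ∅ᶠ) (P Q : Subset n → Set)
           (P⇒Q : ∀ {a b} → a ∈ᶠ d b → P a → Q b) (Q⇒P : ∀ {a b} → a ∈ᶠ d b → Q b → P a) where

    -- `P` and `Q` are two adjacent degrees with `d` leading from `Q` to `P`. Keeping them abstract
    -- lets one proof serve `∂`, which lowers the dimension, and `δ`, which raises it. The chain `c`
    -- collects the partners `b` used along the way.
    matching-exact : ∀ {R} → Matching d f R → ∀ y →
      (∀ {ρ} → ρ ∈ᶠ y → R ρ) → (∀ {ρ} → ρ ∈ᶠ y → P ρ) →
      extend d y ≗ ∅ᶠ → extend f y ≗ ∅ᶠ →
      ∃ λ c → (∀ {ρ} → ρ ∈ᶠ c → Q ρ) × extend d c ≗ y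
    matching-exact (none R∅) y y⊆R _ _ _ =
      ∅ᶠ , (λ ()) , λ ρ → trans (extend-∅ d ρ) (sym (¬-not (R∅ ∘ y⊆R)))
    matching-exact {R} (crit {R′ = R′} ν M R⇒ _ _ ν∉R′ fν) y y⊆R y⊆P dy fy =
      matching-exact M y y⊆R′ y⊆P dy fy
      where
      ν∉y : ¬ (ν ∈ᶠ y)
      -- Every other simplex of `y` lies in `R′`, where `f` does not reach `ν`; so the coefficient 1
      -- of `f ν` at `ν` stays in `f y`.
      ν∉y ν∈y = true≢false (trans (extend-single f ν ν ν∈y others) (trans (fν ν) (⟦⟧-refl ν))) (fy ν)
        where
        others : ∀ {π} → π ∈ᶠ y → π ≢ ν → f π ν ≡ false
        others π∈y π≢ν with R⇒ (y⊆R π∈y)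
        ... | inj₁ π∈R′ = matching-support M π∈R′ ν∉R′
        ... | inj₂ π≡ν  = contradiction π≡ν π≢ν

      y⊆R′ : ∀ {ρ} → ρ ∈ᶠ y → R′ ρ
      y⊆R′ ρ∈y with R⇒ (y⊆R ρ∈y)
      ... | inj₁ ρ∈R′ = ρ∈R′
      ... | inj₂ refl = contradiction ρ∈y ν∉y
    matching-exact {R} (pair {R′ = R′} a b M R⇒ _ a∈db only-b db⇒ _ fdb) y y⊆R y⊆P dy fy = by-a
      where
      b∉y : ¬ (b ∈ᶠ y)
      -- Look at the coefficient of `d y` at `a`: within `R` only `b` has `a` in its image.
      b∉y b∈y = true≢false (trans (extend-single d b a b∈y (only-b ∘ y⊆R)) a∈db) (dy a)

      by-a : ∃ λ c → (∀ {ρ} → ρ ∈ᶠ c → Q ρ) × extend d c ≗ y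
      by-a with y a in ya
      ... | false = matching-exact M y y⊆R′ y⊆P dy fy
        where
        y⊆R′ : ∀ {ρ} → ρ ∈ᶠ y → R′ ρ
        y⊆R′ ρ∈y with R⇒ (y⊆R ρ∈y)
        ... | inj₁ ρ∈R′        = ρ∈R′
        ... | inj₂ (inj₁ refl) = contradiction ya (true≢false ρ∈y)
        ... | inj₂ (inj₂ refl) = contradiction ρ∈y b∉y
      -- Here `c` is a preimage of `y ⊕ d b`; the extra `b` supplies a second `d b`, which cancels
      -- the first.
      ... | true  = c ⊕ ⟦ b ⟧ , c⊆Q , dc
        where
        b∈Q : Q b
        b∈Q = P⇒Q a∈db (y⊆P ya)

        y′ : Family n
        y′ = y ⊕ d b

        -- The simplex `a` is in both summands and drops out, `b` is not in `y`, and the rest of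
        -- `d b` is in `R′`.
        y′⊆R′ : ∀ {ρ} → ρ ∈ᶠ y′ → R′ ρ
        y′⊆R′ {ρ} ρ∈y′ with xor-true⁻ (y ρ) ρ∈y′
        y′⊆R′ {ρ} ρ∈y′ | inj₁ ρ∈y with R⇒ (y⊆R ρ∈y)
        ... | inj₁ ρ∈R′        = ρ∈R′
        ... | inj₂ (inj₁ refl) = contradiction (cong₂ _xor_ ya a∈db) (true≢false ρ∈y′)
        ... | inj₂ (inj₂ refl) = contradiction ρ∈y b∉y
        y′⊆R′ {ρ} ρ∈y′ | inj₂ ρ∈db with db⇒ ρ∈db
        ... | inj₁ ρ∈R′ = ρ∈R′
        ... | inj₂ refl = contradiction (cong₂ _xor_ ya a∈db) (true≢false ρ∈y′)

        y′⊆P : ∀ {ρ} → ρ ∈ᶠ y′ → P ρ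
        y′⊆P {ρ} ρ∈y′ with xor-true⁻ (y ρ) ρ∈y′
        ... | inj₁ ρ∈y  = y⊆P ρ∈y
        ... | inj₂ ρ∈db = Q⇒P ρ∈db b∈Q

        rest = matching-exact M y′ y′⊆R′ y′⊆P
          (extend-⊕-≡ d y (d b) λ ρ → trans (dy ρ) (sym (dd b ρ)))
          (extend-⊕-≡ f y (d b) λ ρ → trans (fy ρ) (sym (fdb ρ)))
        c = proj₁ rest

        c⊆Q : ∀ {ρ} → ρ ∈ᶠ c ⊕ ⟦ b ⟧ → Q ρ
        c⊆Q {ρ} e with xor-true⁻ (c ρ) e
        ... | inj₁ ρ∈c = proj₁ (proj₂ rest) ρ∈c
        ... | inj₂ ρ∈b = subst Q (sym (does⁻ (ρ ≟ˢ b) ρ∈b)) b∈Q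

        dc : extend d (c ⊕ ⟦ b ⟧) ≗ y
        dc ρ = begin
          extend d (c ⊕ ⟦ b ⟧) ρ              ≡⟨ extend-⊕ d c ⟦ b ⟧ ρ ⟩
          extend d c ρ xor extend d ⟦ b ⟧ ρ   ≡⟨ cong₂ _xor_ (proj₂ (proj₂ rest) ρ) (extend-⟦⟧ d b ρ) ⟩
          (y ρ xor d b ρ) xor d b ρ           ≡⟨ xor-assoc (y ρ) _ _ ⟩
          y ρ xor (d b ρ xor d b ρ)           ≡⟨ cong (y ρ xor_) (xor-same (d b ρ)) ⟩
          y ρ xor false                       ≡⟨ xor-identityʳ _ ⟩
          y ρ                                 ∎
          where open ≡-Reasoning

-- The covering relation of the Boolean lattice

infix 7 _⋖_

-- Defined by recursion on the vertices instead of by inclusion and cardinality: this follows the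
-- recursion of `sum₂`, so sums over intermediate sets can be computed by induction.
_⋖_ : ∀ {n} → Subset n → Family n
[]            ⋖ []            = false
(outside ∷ ρ) ⋖ (outside ∷ σ) = ρ ⋖ σ
(outside ∷ ρ) ⋖ (inside  ∷ σ) = ⟦ σ ⟧ ρ
(inside  ∷ ρ) ⋖ (outside ∷ σ) = false
(inside  ∷ ρ) ⋖ (inside  ∷ σ) = ρ ⋖ σ

⋖-irrefl : ∀ {n} (σ : Subset n) → σ ⋖ σ ≡ false
⋖-irrefl []            = refl
⋖-irrefl (outside ∷ σ) = ⋖-irrefl σ
⋖-irrefl (inside  ∷ σ) = ⋖-irrefl σ

⋖⇒≢ : ∀ {n} {ρ σ : Subset n} → ρ ⋖ σ ≡ true → ρ ≢ σ
⋖⇒≢ {ρ = ρ} e refl = true≢false e (⋖-irrefl ρ)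

⋖⇒⊆ : ∀ {n} {ρ σ : Subset n} → ρ ⋖ σ ≡ true → ρ ⊆ σ
⋖⇒⊆ {ρ = []}          {[]}          ()
⋖⇒⊆ {ρ = outside ∷ ρ} {outside ∷ σ} e = s⊆s (⋖⇒⊆ e)
⋖⇒⊆ {ρ = outside ∷ ρ} {inside  ∷ σ} e = out⊆ (⊆-reflexive (does⁻ (ρ ≟ˢ σ) e))
⋖⇒⊆ {ρ = inside  ∷ ρ} {inside  ∷ σ} e = s⊆s (⋖⇒⊆ e)

⋖⇒∣∣ : ∀ {n} {ρ σ : Subset n} → ρ ⋖ σ ≡ true → ∣ σ ∣ ≡ suc ∣ ρ ∣
⋖⇒∣∣ {ρ = []}          {[]}          ()
⋖⇒∣∣ {ρ = outside ∷ ρ} {outside ∷ σ} e = ⋖⇒∣∣ {ρ = ρ} e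
⋖⇒∣∣ {ρ = outside ∷ ρ} {inside  ∷ σ} e = cong (suc ∘ ∣_∣) (sym (does⁻ (ρ ≟ˢ σ) e))
⋖⇒∣∣ {ρ = inside  ∷ ρ} {inside  ∷ σ} e = cong suc (⋖⇒∣∣ {ρ = ρ} e)

inside⊈outside : ∀ {n} {ρ σ : Subset n} → ¬ (inside ∷ ρ ⊆ outside ∷ σ)
inside⊈outside ρ⊆σ with ρ⊆σ here
... | ()

⊆-∣∣⇒≡ : ∀ {n} {ρ σ : Subset n} → ρ ⊆ σ → ∣ σ ∣ ≡ ∣ ρ ∣ → ρ ≡ σ
⊆-∣∣⇒≡ {ρ = []}          {[]}          _   _ = refl
⊆-∣∣⇒≡ {ρ = outside ∷ ρ} {outside ∷ σ} ρ⊆σ e = cong (outside ∷_) (⊆-∣∣⇒≡ (drop-∷-⊆ ρ⊆σ) e)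
⊆-∣∣⇒≡ {ρ = outside ∷ ρ} {inside  ∷ σ} ρ⊆σ e =
  contradiction (p⊆q⇒∣p∣≤∣q∣ (drop-∷-⊆ ρ⊆σ)) (ℕ.<⇒≱ (ℕ.≤-reflexive e))
⊆-∣∣⇒≡ {ρ = inside  ∷ ρ} {outside ∷ σ} ρ⊆σ e = contradiction (λ {x} → ρ⊆σ {x}) inside⊈outside
⊆-∣∣⇒≡ {ρ = inside  ∷ ρ} {inside  ∷ σ} ρ⊆σ e =
  cong (inside ∷_) (⊆-∣∣⇒≡ (drop-∷-⊆ ρ⊆σ) (ℕ.suc-injective e))

⊆-∣∣⇒⋖ : ∀ {n} {ρ σ : Subset n} → ρ ⊆ σ → ∣ σ ∣ ≡ suc ∣ ρ ∣ → ρ ⋖ σ ≡ true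
⊆-∣∣⇒⋖ {ρ = []}          {[]}          _   ()
⊆-∣∣⇒⋖ {ρ = outside ∷ ρ} {outside ∷ σ} ρ⊆σ e = ⊆-∣∣⇒⋖ (drop-∷-⊆ ρ⊆σ) e
⊆-∣∣⇒⋖ {ρ = outside ∷ ρ} {inside  ∷ σ} ρ⊆σ e =
  dec-true (ρ ≟ˢ σ) (⊆-∣∣⇒≡ (drop-∷-⊆ ρ⊆σ) (ℕ.suc-injective e))
⊆-∣∣⇒⋖ {ρ = inside  ∷ ρ} {outside ∷ σ} ρ⊆σ e = contradiction (λ {x} → ρ⊆σ {x}) inside⊈outside
⊆-∣∣⇒⋖ {ρ = inside  ∷ ρ} {inside  ∷ σ} ρ⊆σ e = ⊆-∣∣⇒⋖ (drop-∷-⊆ ρ⊆σ) (ℕ.suc-injective e)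

-- The witness adds to `ρ` the first vertex of `σ` that it lacks. It serves to show that free pairs
-- have codimension one.
⊂⇒∃⋖ : ∀ {n} {ρ σ : Subset n} → ρ ⊂ σ → ∃ λ π → ρ ⋖ π ≡ true × π ⊆ σ
⊂⇒∃⋖ {ρ = []}          {[]}          (_ , () , _)
⊂⇒∃⋖ {ρ = outside ∷ ρ} {outside ∷ σ} ρ⊂σ with ⊂⇒∃⋖ (drop-∷-⊂ ρ⊂σ)
... | π , ρ⋖π , π⊆σ = outside ∷ π , ρ⋖π , s⊆s π⊆σ
⊂⇒∃⋖ {ρ = outside ∷ ρ} {inside  ∷ σ} (ρ⊆σ , _) = inside ∷ ρ , ⟦⟧-refl ρ , s⊆s (drop-∷-⊆ ρ⊆σ)
⊂⇒∃⋖ {ρ = inside  ∷ ρ} {outside ∷ σ} (ρ⊆σ , _) = contradiction (λ {x} → ρ⊆σ {x}) inside⊈outside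
⊂⇒∃⋖ {ρ = inside  ∷ ρ} {inside  ∷ σ} ρ⊂σ with ⊂⇒∃⋖ (drop-∷-⊂ ρ⊂σ)
... | π , ρ⋖π , π⊆σ = inside ∷ π , ρ⋖π , s⊆s π⊆σ

-- ∂ ∂ = 0: a vertex of σ outside ρ enters a chain ρ ⋖ π ⋖ σ either at the first or at the
-- second step, and both happen for the same number of chains.
⋖-diamond : ∀ {n} (ρ σ : Subset n) → sum₂ (λ π → ρ ⋖ π ∧ π ⋖ σ) ≡ false
⋖-diamond []            []            = refl
⋖-diamond {suc n} (outside ∷ ρ) (outside ∷ σ) =
  cong₂ _xor_ (⋖-diamond ρ σ) (sum₂-zero {n} λ π → ∧-zeroʳ (⟦ π ⟧ ρ))
⋖-diamond (outside ∷ ρ) (inside  ∷ σ) = trans (cong₂ _xor_ last first) (xor-same (ρ ⋖ σ))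
  where
  last : sum₂ (λ π → ρ ⋖ π ∧ ⟦ σ ⟧ π) ≡ ρ ⋖ σ
  last = trans
    (sum₂-single _ σ λ {π} π≢σ → trans (cong (ρ ⋖ π ∧_) (⟦⟧-≢ π≢σ)) (∧-zeroʳ _))
    (trans (cong (ρ ⋖ σ ∧_) (⟦⟧-refl σ)) (∧-identityʳ _))

  first : sum₂ (λ π → ⟦ π ⟧ ρ ∧ π ⋖ σ) ≡ ρ ⋖ σ
  first = trans
    (sum₂-single _ ρ λ {π} π≢ρ → cong (_∧ π ⋖ σ) (⟦⟧-≢ (π≢ρ ∘ sym)))
    (cong (_∧ ρ ⋖ σ) (⟦⟧-refl ρ))
⋖-diamond {suc n} (inside  ∷ ρ) (outside ∷ σ) =
  cong₂ _xor_ (sum₂-zero {n} λ _ → refl) (sum₂-zero {n} λ π → ∧-zeroʳ (ρ ⋖ π))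
⋖-diamond {suc n} (inside  ∷ ρ) (inside  ∷ σ) =
  cong₂ _xor_ (sum₂-zero {n} λ _ → refl) (⋖-diamond ρ σ)

-- Incidence in a simplicial complex

i-1+1≡i : ∀ i → i - 1ℤ + 1ℤ ≡ i
i-1+1≡i i = trans (ℤ.+-assoc i -1ℤ 1ℤ) (ℤ.+-identityʳ i)

i+1-1≡i : ∀ i → i + 1ℤ - 1ℤ ≡ i
i+1-1≡i i = trans (ℤ.+-assoc i 1ℤ -1ℤ) (ℤ.+-identityʳ i)

∣∣⇒dim : ∀ {n} {ρ σ : Subset n} → ∣ σ ∣ ≡ suc ∣ ρ ∣ → dim σ ≡ dim ρ + 1ℤ
∣∣⇒dim {ρ = ρ} e = trans (cong (λ k → + k - 1ℤ) e) (sym (i-1+1≡i (+ ∣ ρ ∣)))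

dim⇒∣∣ : ∀ {n} {ρ σ : Subset n} → dim σ ≡ dim ρ + 1ℤ → ∣ σ ∣ ≡ suc ∣ ρ ∣
dim⇒∣∣ {ρ = ρ} {σ} e = ℤ.+-injective (begin
  + (∣ σ ∣)           ≡⟨ i-1+1≡i (+ ∣ σ ∣) ⟨
  dim σ + 1ℤ          ≡⟨ cong (_+ 1ℤ) e ⟩
  dim ρ + 1ℤ + 1ℤ     ≡⟨ cong (_+ 1ℤ) (i-1+1≡i (+ ∣ ρ ∣)) ⟩
  (+ ∣ ρ ∣) + 1ℤ      ≡⟨ ℤ.+-comm (+ ∣ ρ ∣) 1ℤ ⟩
  + (suc ∣ ρ ∣)       ∎)
  where open ≡-Reasoning

module _ {n} (K : SimplicialComplex n) where

  -- Both arguments are required to lie in K, so that ∂ and δ become transposes of each other.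
  incidence : Subset n → Family n
  incidence σ ρ = simplices K σ ∧ simplices K ρ ∧ ρ ⋖ σ

  incidence⁻ : ∀ {σ ρ} → incidence σ ρ ≡ true → σ ∈ᶠ simplices K × ρ ∈ᶠ simplices K × ρ ⋖ σ ≡ true
  incidence⁻ e with ∧-true⁻ e
  ... | σ∈K , e′ = σ∈K , ∧-true⁻ e′

  incidence-dim : ∀ {σ ρ} → incidence σ ρ ≡ true → dim σ ≡ dim ρ + 1ℤ
  incidence-dim {σ} {ρ} e = ∣∣⇒dim {ρ = ρ} {σ} (⋖⇒∣∣ {ρ = ρ} {σ} (proj₂ (proj₂ (incidence⁻ e))))

  ∈⁽⁾⁻ : ∀ {p σ} → σ ∈ᶠ K ⁽ p ⁾ → σ ∈ᶠ simplices K × dim σ ≡ p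
  ∈⁽⁾⁻ {p} {σ} e with ∧-true⁻ e
  ... | σ∈K , d = σ∈K , does⁻ (dim σ ℤ.≟ p) d

  ∈⁽⁾⁺ : ∀ {p σ} → σ ∈ᶠ simplices K → dim σ ≡ p → σ ∈ᶠ K ⁽ p ⁾
  ∈⁽⁾⁺ {p} {σ} σ∈K d = ∧-true⁺ σ∈K (dec-true (dim σ ℤ.≟ p) d)

  -- A cover is an inclusion with dimensions differing by one. Membership of `σ` is assumed because
  -- `incidence` tests it while `∂ˢ` does not.
  ∂ˢ≗incidence : ∀ {σ} → σ ∈ᶠ simplices K → ∂ˢ K σ ≗ incidence σ
  ∂ˢ≗incidence {σ} σ∈K ρ = ≡-by-true to from
    where
    to : ∂ˢ K σ ρ ≡ true → incidence σ ρ ≡ true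
    to e with ∧-true⁻ e
    ... | e₁ , e₂ with ∈⁽⁾⁻ e₁
    ...   | ρ∈K , d = ∧-true⁺ σ∈K (∧-true⁺ ρ∈K (⊆-∣∣⇒⋖ (does⁻ (ρ ⊆? σ) e₂)
                        (dim⇒∣∣ {ρ = ρ} {σ} (trans (sym (i-1+1≡i (dim σ))) (cong (_+ 1ℤ) (sym d))))))

    from : incidence σ ρ ≡ true → ∂ˢ K σ ρ ≡ true
    from e with incidence⁻ e
    ... | _ , ρ∈K , ρ⋖σ = ∧-true⁺
      (∈⁽⁾⁺ ρ∈K (trans (sym (i+1-1≡i (dim ρ))) (cong (_- 1ℤ) (sym (incidence-dim e)))))
      (dec-true (ρ ⊆? σ) (⋖⇒⊆ ρ⋖σ))

  δˢ≗incidence : ∀ {ρ} → ρ ∈ᶠ simplices K → δˢ K ρ ≗ flip incidence ρ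
  δˢ≗incidence {ρ} ρ∈K σ = ≡-by-true to from
    where
    to : δˢ K ρ σ ≡ true → incidence σ ρ ≡ true
    to e with ∧-true⁻ e
    ... | e₁ , e₂ with ∈⁽⁾⁻ e₁
    ...   | σ∈K , d = ∧-true⁺ σ∈K (∧-true⁺ ρ∈K
                        (⊆-∣∣⇒⋖ (does⁻ (ρ ⊆? σ) e₂) (dim⇒∣∣ {ρ = ρ} {σ} d)))

    from : incidence σ ρ ≡ true → δˢ K ρ σ ≡ true
    from e with incidence⁻ e
    ... | σ∈K , _ , ρ⋖σ = ∧-true⁺ (∈⁽⁾⁺ σ∈K (incidence-dim e)) (dec-true (ρ ⊆? σ) (⋖⇒⊆ ρ⋖σ))

  ⊇-nonempty : ∀ {ρ π} → ρ ∈ᶠ simplices K → ρ ⊆ π → Nonempty π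
  ⊇-nonempty ρ∈K ρ⊆π with nonempty K ρ∈K
  ... | x , x∈ρ = x , ρ⊆π x∈ρ

  -- The middle simplex `π` is in `K` automatically: it is a face of `σ`, and it is non-empty
  -- because it contains `ρ`. So the membership factor on the right is free of `π`.
  incidence-∧ : ∀ σ ρ π → incidence σ π ∧ incidence π ρ ≡
                (simplices K σ ∧ simplices K ρ) ∧ (ρ ⋖ π ∧ π ⋖ σ)
  incidence-∧ σ ρ π = ≡-by-true to from
    where
    to : incidence σ π ∧ incidence π ρ ≡ true → (simplices K σ ∧ simplices K ρ) ∧ (ρ ⋖ π ∧ π ⋖ σ) ≡ true
    to e with ∧-true⁻ e
    ... | e₁ , e₂ with incidence⁻ e₁ | incidence⁻ e₂
    ...   | σ∈K , _ , π⋖σ | _ , ρ∈K , ρ⋖π = ∧-true⁺ (∧-true⁺ σ∈K ρ∈K) (∧-true⁺ ρ⋖π π⋖σ)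

    from : (simplices K σ ∧ simplices K ρ) ∧ (ρ ⋖ π ∧ π ⋖ σ) ≡ true → incidence σ π ∧ incidence π ρ ≡ true
    from e with ∧-true⁻ e
    ... | e₁ , e₂ with ∧-true⁻ e₁ | ∧-true⁻ e₂
    ...   | σ∈K , ρ∈K | ρ⋖π , π⋖σ =
      ∧-true⁺ (∧-true⁺ σ∈K (∧-true⁺ π∈K π⋖σ)) (∧-true⁺ π∈K (∧-true⁺ ρ∈K ρ⋖π))
      where π∈K = closed K σ∈K (⋖⇒⊆ π⋖σ) (⊇-nonempty ρ∈K (⋖⇒⊆ ρ⋖π))

  -- The membership factor is constant in `π`: either it annihilates every term, or the sum is that
  -- of `⋖-diamond`. Stated for the incidence matrix, this gives `∂ ∂ = 0` and, transposed,
  -- `δ δ = 0`.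
  incidence² : ∀ σ ρ → sum₂ (λ π → incidence σ π ∧ incidence π ρ) ≡ false
  incidence² σ ρ = trans (sum₂-cong (incidence-∧ σ ρ)) go
    where
    go : sum₂ (λ π → (simplices K σ ∧ simplices K ρ) ∧ (ρ ⋖ π ∧ π ⋖ σ)) ≡ false
    go with simplices K σ ∧ simplices K ρ
    ... | true  = ⋖-diamond ρ σ
    ... | false = sum₂-zero {n} λ _ → refl

-- Elementary fillings and expansions

module _ {n} {L K : SimplicialComplex n} {ν : Subset n} (E : ElementaryFilling L K ν) where
  open ElementaryFilling E
  open Facet facet

  fill-⇒ : ∀ {ρ} → ρ ∈ᶠ simplices K → ρ ∈ᶠ simplices L ⊎ ρ ≡ ν
  fill-⇒ {ρ} ρ∈K with ρ ≟ˢ ν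
  ... | yes ρ≡ν = inj₂ ρ≡ν
  ... | no  ρ≢ν = inj₁ (trans (removal ρ) (cong₂ _∧_ ρ∈K (cong not (⟦⟧-≢ ρ≢ν))))

  fill-⊇ : ∀ {ρ} → ρ ∈ᶠ simplices L → ρ ∈ᶠ simplices K
  fill-⊇ {ρ} ρ∈L = proj₁ (∧-true⁻ (trans (sym (removal ρ)) ρ∈L))

  fill-∉ : simplices L ν ≡ false
  fill-∉ = trans (removal ν) (trans (cong (λ b → simplices K ν ∧ not b) (⟦⟧-refl ν)) (∧-zeroʳ _))

module _ {n} {L K : SimplicialComplex n} {σ τ : Subset n} (E : ElementaryExpansion L K σ τ) where
  open ElementaryExpansion E
  open FreePair freePair

  expand-⇒ : ∀ {ρ} → ρ ∈ᶠ simplices K → ρ ∈ᶠ simplices L ⊎ ρ ≡ σ ⊎ ρ ≡ τ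
  expand-⇒ {ρ} ρ∈K with ρ ≟ˢ σ | ρ ≟ˢ τ
  ... | yes ρ≡σ | _       = inj₂ (inj₁ ρ≡σ)
  ... | no  _   | yes ρ≡τ = inj₂ (inj₂ ρ≡τ)
  ... | no  ρ≢σ | no  ρ≢τ =
    inj₁ (trans (removal ρ) (cong₂ _∧_ ρ∈K (cong not (cong₂ _∨_ (⟦⟧-≢ ρ≢σ) (⟦⟧-≢ ρ≢τ)))))

  expand-⊇ : ∀ {ρ} → ρ ∈ᶠ simplices L → ρ ∈ᶠ simplices K
  expand-⊇ {ρ} ρ∈L = proj₁ (∧-true⁻ (trans (sym (removal ρ)) ρ∈L))

  -- A free pair is only required to be a proper inclusion. Some `π` inside `τ` covers `σ`; it is a
  -- simplex of `K` strictly containing `σ`, so freeness forces it to be `τ`.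
  expand-⋖ : σ ⋖ τ ≡ true
  expand-⋖ with ⊂⇒∃⋖ σ⊂τ
  ... | π , σ⋖π , π⊆τ = subst (λ ρ → σ ⋖ ρ ≡ true)
    (only (closed K τ∈K π⊆τ (⊇-nonempty K σ∈K (⋖⇒⊆ σ⋖π))) (⋖⇒⊆ σ⋖π) (⋖⇒≢ σ⋖π ∘ sym)) σ⋖π

  coface-of-lower : ∀ {ρ} → ρ ∈ᶠ simplices K → σ ⋖ ρ ≡ true → ρ ≡ τ
  coface-of-lower ρ∈K σ⋖ρ = only ρ∈K (⋖⇒⊆ σ⋖ρ) (⋖⇒≢ σ⋖ρ ∘ sym)

  face-of-upper : ∀ {ρ} → Nonempty ρ → ρ ⋖ τ ≡ true → ρ ∈ᶠ simplices L ⊎ ρ ≡ σ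
  face-of-upper ρ≢∅ ρ⋖τ with expand-⇒ (closed K τ∈K (⋖⇒⊆ ρ⋖τ) ρ≢∅)
  ... | inj₁ ρ∈L        = inj₁ ρ∈L
  ... | inj₂ (inj₁ ρ≡σ) = inj₂ ρ≡σ
  ... | inj₂ (inj₂ ρ≡τ) = contradiction ρ≡τ (⋖⇒≢ ρ⋖τ)

-- Morse sequences as matchings

module _ {n} (K : SimplicialComplex n) (f : Subset n → Family n) where

  -- The incidences remain those of the final `K` while `L` runs back through the earlier complexes;
  -- hence the conditions on `f` are passed separately and restricted at each step.
  homology-matching : ∀ {L} (W : MorseSequence L) →
    (∀ {ρ} → ρ ∈ᶠ simplices L → ρ ∈ᶠ simplices K) →
    (∀ {ν} → Critical W ν → f ν ≗ ⟦ ν ⟧) →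
    (∀ {τ} → UpperRegular W τ → f τ ≗ ∅ᶠ) →
    (∀ {τ} → UpperRegular W τ → extend f (∂ˢ K τ) ≗ ∅ᶠ) →
    Matching (incidence K) f (_∈ᶠ simplices L)
  homology-matching (start L∅) _ _ _ _ = none λ {ρ} ρ∈L → true≢false ρ∈L (L∅ ρ)
  homology-matching (fill W ν E) ⊆K fc fu fd =
    crit ν (homology-matching W (⊆K ∘ fill-⊇ E) (fc ∘ inj₁) fu fd)
      (fill-⇒ E) (fill-⊇ E) (Facet.ν∈K (ElementaryFilling.facet E))
      (λ ν∈L → true≢false ν∈L (fill-∉ E)) (fc (inj₂ refl))
  homology-matching (expand W σ τ E) ⊆K fc fu fd =
    pair σ τ (homology-matching W (⊆K ∘ expand-⊇ E) fc (fu ∘ inj₁) (fd ∘ inj₁))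
      (expand-⇒ E) (expand-⊇ E)
      (∧-true⁺ (⊆K τ∈K) (∧-true⁺ (⊆K σ∈K) (expand-⋖ E)))
      -- Simplices added later may also cover `σ`, but within the current complex freeness leaves
      -- only `τ`.
      (λ ρ∈L ρ≢τ → ¬-not λ e → ρ≢τ (coface-of-lower E ρ∈L (proj₂ (proj₂ (incidence⁻ K e)))))
      (λ e → let _ , ρ∈K , ρ⋖τ = incidence⁻ K e in face-of-upper E (nonempty K ρ∈K) ρ⋖τ)
      (fu (inj₂ refl))
      (λ ρ → trans (sym (extend-congʳ f (∂ˢ≗incidence K (⊆K τ∈K)) ρ)) (fd (inj₂ refl) ρ))
    where open FreePair (ElementaryExpansion.freePair E)

  -- When the sequence is read forwards, this is what remains to be eliminated once `L` has been
  -- passed.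
  Outside : SimplicialComplex n → Subset n → Set
  Outside L ρ = ρ ∈ᶠ simplices K × simplices L ρ ≡ false

  outside-mono : ∀ {L L′ : SimplicialComplex n} → (∀ {ρ} → ρ ∈ᶠ simplices L → ρ ∈ᶠ simplices L′) →
                 ∀ {ρ} → Outside L′ ρ → Outside L ρ
  outside-mono L⊆L′ (ρ∈K , ρ∉L′) = ρ∈K , ¬-not λ ρ∈L → true≢false (L⊆L′ ρ∈L) ρ∉L′

  -- The sequence is a snoc-list but is processed from its start, hence the accumulator.
  cohomology-matching : ∀ {L} (W : MorseSequence L) →
    (∀ {ρ} → ρ ∈ᶠ simplices L → ρ ∈ᶠ simplices K) →
    (∀ {ν} → Critical W ν → f ν ≗ ⟦ ν ⟧) →
    (∀ {σ} → LowerRegular W σ → f σ ≗ ∅ᶠ) →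
    (∀ {σ} → LowerRegular W σ → extend f (δˢ K σ) ≗ ∅ᶠ) →
    Matching (flip (incidence K)) f (Outside L) →
    ∃ λ L₀ → simplices L₀ ≗ ∅ᶠ × Matching (flip (incidence K)) f (Outside L₀)
  cohomology-matching {L} (start L∅) _ _ _ _ M = L , L∅ , M
  cohomology-matching {L} (fill {L′} W ν E) ⊆K fc fl fd M =
    cohomology-matching W (⊆K ∘ fill-⊇ E) (fc ∘ inj₁) fl fd
      (crit ν M ⇒ (outside-mono {L′} {L} (fill-⊇ E)) (⊆K ν∈K , fill-∉ E)
        (λ ν∉L → true≢false ν∈K (proj₂ ν∉L)) (fc (inj₂ refl)))
    where
    open Facet (ElementaryFilling.facet E)

    ⇒ : ∀ {ρ} → Outside L′ ρ → Outside L ρ ⊎ ρ ≡ ν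
    ⇒ {ρ} (ρ∈K , ρ∉L′) with simplices L ρ in e
    ... | false = inj₁ (ρ∈K , refl)
    ... | true with fill-⇒ E e
    ...   | inj₁ ρ∈L′ = contradiction ρ∉L′ (true≢false ρ∈L′)
    ...   | inj₂ ρ≡ν  = inj₂ ρ≡ν
  cohomology-matching {L} (expand {L′} W σ τ E) ⊆K fc fl fd M =
    cohomology-matching W (⊆K ∘ expand-⊇ E) fc (fl ∘ inj₁) (fd ∘ inj₁)
      (pair τ σ M ⇒ (outside-mono {L′} {L} (expand-⊇ E))
        (∧-true⁺ (⊆K τ∈K) (∧-true⁺ (⊆K σ∈K) (expand-⋖ E)))
        (λ ρ∉L′ ρ≢σ → ¬-not (not-face ρ∉L′ ρ≢σ))
        coface
        (fl (inj₂ refl))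
        (λ ρ → trans (sym (extend-congʳ f (δˢ≗incidence K (⊆K σ∈K)) ρ)) (fd (inj₂ refl) ρ)))
    where
    open FreePair (ElementaryExpansion.freePair E)

    ⇒ : ∀ {ρ} → Outside L′ ρ → Outside L ρ ⊎ ρ ≡ τ ⊎ ρ ≡ σ
    ⇒ {ρ} (ρ∈K , ρ∉L′) with simplices L ρ in e
    ... | false = inj₁ (ρ∈K , refl)
    ... | true with expand-⇒ E e
    ...   | inj₁ ρ∈L′        = contradiction ρ∉L′ (true≢false ρ∈L′)
    ...   | inj₂ (inj₁ ρ≡σ) = inj₂ (inj₂ ρ≡σ)
    ...   | inj₂ (inj₂ ρ≡τ) = inj₂ (inj₁ ρ≡τ)

    -- All codimension-one faces of `τ` except `σ` were present before the expansion, so none of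
    -- them is outside `L′`.
    not-face : ∀ {ρ} → Outside L′ ρ → ρ ≢ σ → incidence K τ ρ ≢ true
    not-face (ρ∈K , ρ∉L′) ρ≢σ e with face-of-upper E (nonempty K ρ∈K) (proj₂ (proj₂ (incidence⁻ K e)))
    ... | inj₁ ρ∈L′ = true≢false ρ∈L′ ρ∉L′
    ... | inj₂ ρ≡σ  = ρ≢σ ρ≡σ

    -- A simplex covering `σ` is either added after `L` or already in `L`, and there freeness makes
    -- it `τ`.
    coface : ∀ {ρ} → incidence K ρ σ ≡ true → Outside L ρ ⊎ ρ ≡ τ
    coface {ρ} e with incidence⁻ K e | simplices L ρ in ρ∈L
    ... | ρ∈K , _ , _   | false = inj₁ (ρ∈K , refl)
    ... | _   , _ , σ⋖ρ | true  = inj₂ (coface-of-lower E ρ∈L σ⋖ρ)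

-- Chains, and the two halves of the theorem

chain-⊕ : ∀ {n} {K : SimplicialComplex n} {p} {z z′} → IsChain K p z → IsChain K p z′ → IsChain K p (z ⊕ z′)
chain-⊕ {z = z} zc z′c {σ} e with xor-true⁻ (z σ) e
... | inj₁ σ∈z  = zc σ∈z
... | inj₂ σ∈z′ = z′c σ∈z′

module _ {n} (K : SimplicialComplex n) {p : ℤ} {c : Family n} (cc : IsChain K p c) where

  chain⊆K : ∀ {σ} → σ ∈ᶠ c → σ ∈ᶠ simplices K
  chain⊆K = proj₁ ∘ ∈⁽⁾⁻ K {p} ∘ cc

  ∂≗incidence : ∂ K c ≗ extend (incidence K) c
  ∂≗incidence = extend-congˡ (∂ˢ≗incidence K ∘ chain⊆K)

  δ≗incidence : δ K c ≗ extend (flip (incidence K)) c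
  δ≗incidence = extend-congˡ (δˢ≗incidence K ∘ chain⊆K)

theorem8 : (n : ℕ) (K : SimplicialComplex n) (W : MorseSequence K) →
    ((⋏ : Subset n → Family n) → IsReferenceMap W ⋏ →
    (p : ℤ) (z z′ : Family n) → IsCycle K p z → IsCycle K p z′ →
    extend ⋏ z ≗ extend ⋏ z′ → IsBoundary K p (z ⊕ z′))
    ×
    ((⋎ : Subset n → Family n) → IsCoreferenceMap W ⋎ →
    (p : ℤ) (z z′ : Family n) → IsCocycle K p z → IsCocycle K p z′ →
    extend ⋎ z ≗ extend ⋎ z′ → IsCoboundary K p (z ⊕ z′))
theorem8 n K W = homologous , cohomologous
  where
  homologous : (⋏ : Subset n → Family n) → IsReferenceMap W ⋏ →
    (p : ℤ) (z z′ : Family n) → IsCycle K p z → IsCycle K p z′ →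
    extend ⋏ z ≗ extend ⋏ z′ → IsBoundary K p (z ⊕ z′)
  homologous ⋏ ref p z z′ (zc , ∂z) (z′c , ∂z′) e =
    -- By linearity `z ⊕ z′` is a cycle with zero reference, and the elimination starts from all of
    -- `K`.
    let c , cc , dc = matching-exact (incidence² K) (_∈ᶠ K ⁽ p ⁾) (_∈ᶠ K ⁽ p + 1ℤ ⁾) up down
          (homology-matching K ⋏ W id on-critical on-upper on-∂-upper) (z ⊕ z′)
          (chain⊆K K {p} yc) yc
          (λ ρ → trans (sym (∂≗incidence K {p} yc ρ))
                   (extend-⊕-≡ (∂ˢ K) z z′ (λ π → trans (∂z π) (sym (∂z′ π))) ρ))
          (extend-⊕-≡ ⋏ z z′ e)
    in c , cc , λ ρ → trans (∂≗incidence K {p + 1ℤ} cc ρ) (dc ρ)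
    where
    open IsReferenceMap ref

    yc : IsChain K p (z ⊕ z′)
    yc = chain-⊕ {K = K} {p} zc z′c

    up : ∀ {a b} → incidence K b a ≡ true → a ∈ᶠ K ⁽ p ⁾ → b ∈ᶠ K ⁽ p + 1ℤ ⁾
    up i a∈ = ∈⁽⁾⁺ K (proj₁ (incidence⁻ K i))
      (trans (incidence-dim K i) (cong (_+ 1ℤ) (proj₂ (∈⁽⁾⁻ K {p} a∈))))

    down : ∀ {a b} → incidence K b a ≡ true → b ∈ᶠ K ⁽ p + 1ℤ ⁾ → a ∈ᶠ K ⁽ p ⁾
    down {a} i b∈ = ∈⁽⁾⁺ K (proj₁ (proj₂ (incidence⁻ K i)))
      (trans (sym (i+1-1≡i (dim a))) (trans (cong (_- 1ℤ)
        (trans (sym (incidence-dim K i)) (proj₂ (∈⁽⁾⁻ K {p + 1ℤ} b∈)))) (i+1-1≡i p)))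

  cohomologous : (⋎ : Subset n → Family n) → IsCoreferenceMap W ⋎ →
    (p : ℤ) (z z′ : Family n) → IsCocycle K p z → IsCocycle K p z′ →
    extend ⋎ z ≗ extend ⋎ z′ → IsCoboundary K p (z ⊕ z′)
  cohomologous ⋎ coref p z z′ (zc , δz) (z′c , δz′) e =
    -- The accumulator starts at the complement of `K` in itself, which is empty, and ends at the
    -- complement of the empty complex `L₀`, which is all of `K`.
    let L₀ , L₀∅ , M = cohomology-matching K ⋎ W id on-critical on-lower on-δ-lower
          (none λ { (ρ∈K , ρ∉K) → true≢false ρ∈K ρ∉K })
        c , cc , dc = matching-exact
          -- `δ δ = 0` is the transpose of `∂ ∂ = 0`: exchange `σ` and `ρ` and the two factors.
          (λ σ ρ → trans (sum₂-cong λ π → ∧-comm (incidence K π σ) (incidence K ρ π)) (incidence² K ρ σ))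
          (_∈ᶠ K ⁽ p ⁾) (_∈ᶠ K ⁽ p - 1ℤ ⁾) down up
          M (z ⊕ z′)
          (λ {ρ} ρ∈y → chain⊆K K {p} yc ρ∈y , L₀∅ ρ) yc
          (λ ρ → trans (sym (δ≗incidence K {p} yc ρ))
                   (extend-⊕-≡ (δˢ K) z z′ (λ π → trans (δz π) (sym (δz′ π))) ρ))
          (extend-⊕-≡ ⋎ z z′ e)
    in c , cc , λ ρ → trans (δ≗incidence K {p - 1ℤ} cc ρ) (dc ρ)
    where
    open IsCoreferenceMap coref

    yc : IsChain K p (z ⊕ z′)
    yc = chain-⊕ {K = K} {p} zc z′c

    down : ∀ {a b} → incidence K a b ≡ true → a ∈ᶠ K ⁽ p ⁾ → b ∈ᶠ K ⁽ p - 1ℤ ⁾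
    down {b = b} i a∈ = ∈⁽⁾⁺ K (proj₁ (proj₂ (incidence⁻ K i)))
      (trans (sym (i+1-1≡i (dim b))) (cong (_- 1ℤ)
        (trans (sym (incidence-dim K i)) (proj₂ (∈⁽⁾⁻ K {p} a∈)))))

    up : ∀ {a b} → incidence K a b ≡ true → b ∈ᶠ K ⁽ p - 1ℤ ⁾ → a ∈ᶠ K ⁽ p ⁾
    up i b∈ = ∈⁽⁾⁺ K (proj₁ (incidence⁻ K i))
      (trans (incidence-dim K i) (trans (cong (_+ 1ℤ) (proj₂ (∈⁽⁾⁻ K {p - 1ℤ} b∈))) (i-1+1≡i p)))
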